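{- Let $f:\mathbb{N}\to\mathbb{N}$ be a function such that for all positive natural numbers $x,y$ there exist natural numbers $a,b$ with $\gcd(a,f(y))=1$ and $$f(x+y)=a\cdot f(x)+b\cdot f(y).$$ Then $f$ distributes over the greatest common divisor on positive arguments: for all positive natural numbers $m,n$, $$f(\gcd(m,n))=\gcd(f(m),f(n)).$$
   Context: $\mathbb{N}$ denotes the natural numbers including $0$. The greatest common divisor is taken with respect to the divisibility ordering on $\mathbb{N}$, i.e. $\gcd(m,n)$ is the unique natural number such that, for all $k\in\mathbb{N}$, $k\mid m$ and $k\mid n$ if and only if $k\mid \gcd(m,n)$; in particular $\gcd(m,0)=m$ and $\gcd(0,0)=0$. -}

module Defs where

{-# OPTIONS --safe #-}
-- Since a is coprime to f y, gcd (f (x + y)) (f y) = gcd (a * f x) (f y) = gcd (f x) (f y),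
-- so the subtractive Euclidean algorithm on (m , n) is mirrored step by step on (f m , f n).
module Submission where

open import Defs
open import Data.Nat using (ℕ; _+_; _*_; _<_; _∸_)
open import Data.Nat.Coprimality using (Coprime; coprime-divisor; gcd≡1⇒coprime)
open import Data.Nat.Divisibility using
  (_∣_; ∣-refl; ∣-trans; ∣-antisym; ∣m∣n⇒∣m+n; ∣m+n∣m⇒∣n; ∣n⇒∣m*n)
open import Data.Nat.GCD using (gcd; gcd[m,n]∣m; gcd[m,n]∣n; gcd-greatest; gcd-comm; gcd-zeroˡ)
open import Data.Nat.Induction using (Acc; acc; <-wellFounded)
open import Data.Nat.Properties using
  (<-cmp; <⇒≤; m∸n+n≡m; m<n⇒0<n∸m; m<m+n; m<n+m; +-comm; *-identityˡ)
open import Data.Product using (_×_; ∃-syntax; _,_)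
open import Relation.Binary.Definitions using (Symmetric; tri<; tri≈; tri>)
open import Relation.Binary.PropositionalEquality using (_≡_; refl; sym; trans; cong; subst; subst₂)

-- Replacing `(m + n , n)` by `(m , n)` preserves the gcd of the arguments and, by the hypothesis on
-- `f`, also the gcd of the values. Both facts are cases of `gcd-coprime-step`. `euclid-induction`
-- then descends to a pair of equal numbers, where the claim is trivial.

gcd-idem : ∀ n → gcd n n ≡ n
gcd-idem n = ∣-antisym (gcd[m,n]∣m n n) (gcd-greatest ∣-refl ∣-refl)

-- A common divisor `d` of `a * x + b * y` and `y` divides `a * x`. Whatever divides both `d` and
-- `a` divides `gcd a y`, which is 1, so `d` can be cancelled against `a` and divides `x`.
gcd-coprime-step : ∀ a b x y → gcd a y ≡ 1 → gcd (a * x + b * y) y ≡ gcd x y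
gcd-coprime-step a b x y gcd[a,y]≡1 = ∣-antisym (gcd-greatest d∣x d∣y)
  (gcd-greatest
    (∣m∣n⇒∣m+n (∣n⇒∣m*n a (gcd[m,n]∣m x y)) (∣n⇒∣m*n b (gcd[m,n]∣n x y)))
    (gcd[m,n]∣n x y))
  where
  d : ℕ
  d = gcd (a * x + b * y) y

  d∣y : d ∣ y
  d∣y = gcd[m,n]∣n (a * x + b * y) y

  d∣ax : d ∣ a * x
  d∣ax = ∣m+n∣m⇒∣n
    (subst (d ∣_) (+-comm (a * x) (b * y)) (gcd[m,n]∣m (a * x + b * y) y))
    (∣n⇒∣m*n b d∣y)

  d⊥a : Coprime d a
  d⊥a (k∣d , k∣a) = gcd≡1⇒coprime gcd[a,y]≡1 (k∣a , ∣-trans k∣d d∣y)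

  d∣x : d ∣ x
  d∣x = coprime-divisor d⊥a d∣ax

gcd[m+n,n]≡gcd[m,n] : ∀ m n → gcd (m + n) n ≡ gcd m n
gcd[m+n,n]≡gcd[m,n] m n = subst₂ (λ u v → gcd (u + v) n ≡ gcd m n)
  (*-identityˡ m) (*-identityˡ n) (gcd-coprime-step 1 1 m n (gcd-zeroˡ n))

-- The subtractive Euclidean algorithm as an induction principle. Stopping at equal arguments, not
-- at zero, keeps every pair positive, as the hypothesis on `f` demands.
euclid-induction : (P : ℕ → ℕ → Set) → Symmetric P → (∀ n → P n n) →
  (∀ m n → 0 < m → 0 < n → P m n → P (m + n) n) →
  ∀ m n → 0 < m → 0 < n → P m n
euclid-induction P P-sym P-diag P-step = λ m n → go m n (<-wellFounded (m + n))
  where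
  go : ∀ m n → Acc _<_ (m + n) → 0 < m → 0 < n → P m n
  go m n (acc rec) 0<m 0<n with <-cmp m n
  ... | tri≈ _ refl _ = P-diag m
  -- The pair `(n ∸ m , m)` has sum `n`, below `m + n` since `0 < m`. `P-step` gives `P n m`, which
  -- symmetry turns round.
  ... | tri< m<n _ _ = P-sym (subst (λ k → P k m) n∸m+m≡n
          (P-step (n ∸ m) m (m<n⇒0<n∸m m<n) 0<m
            (go (n ∸ m) m (rec (subst (_< m + n) (sym n∸m+m≡n) (m<n+m n 0<m)))
              (m<n⇒0<n∸m m<n) 0<m)))
    where n∸m+m≡n = m∸n+n≡m (<⇒≤ m<n)
  ... | tri> _ _ n<m = subst (λ k → P k n) m∸n+n≡m′
          (P-step (m ∸ n) n (m<n⇒0<n∸m n<m) 0<n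
            (go (m ∸ n) n (rec (subst (_< m + n) (sym m∸n+n≡m′) (m<m+n m 0<n)))
              (m<n⇒0<n∸m n<m) 0<n))
    where m∸n+n≡m′ = m∸n+n≡m (<⇒≤ n<m)

lemma24 : (f : ℕ → ℕ) →
    (∀ x y → 0 < x → 0 < y →
    ∃[ a ] ∃[ b ] (gcd a (f y) ≡ 1 × f (x + y) ≡ a * f x + b * f y)) →
    ∀ m n → 0 < m → 0 < n → f (gcd m n) ≡ gcd (f m) (f n)
lemma24 f H = euclid-induction (λ m n → f (gcd m n) ≡ gcd (f m) (f n)) swap diag step
  where
  swap : Symmetric (λ m n → f (gcd m n) ≡ gcd (f m) (f n))
  swap {m} {n} eq = trans (cong f (gcd-comm n m)) (trans eq (gcd-comm (f m) (f n)))

  diag : ∀ n → f (gcd n n) ≡ gcd (f n) (f n)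
  diag n = trans (cong f (gcd-idem n)) (sym (gcd-idem (f n)))

  step : ∀ m n → 0 < m → 0 < n →
    f (gcd m n) ≡ gcd (f m) (f n) → f (gcd (m + n) n) ≡ gcd (f (m + n)) (f n)
  -- With `x = m` and `y = n`, the coefficient `a` is coprime to `f n`, so the gcd of the values
  -- reduces to `gcd (f m) (f n)`.
  step m n 0<m 0<n eq with a , b , a⊥fn , f[m+n]≡ ← H m n 0<m 0<n =
    trans (cong f (gcd[m+n,n]≡gcd[m,n] m n)) (trans eq (sym
      (trans (cong (λ k → gcd k (f n)) f[m+n]≡) (gcd-coprime-step a b (f m) (f n) a⊥fn))))
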